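{- Let $n\ge 2$ be an integer, let $k\ge t\ge 2$ be integers, and let $s_1,\dots,s_k$ and $M$ be positive integers. If there exists an $\mathrm{OA}(M,s_1s_2\cdots s_k,t)$, then there exists an optimal $$\mathrm{NOA}\bigl((nM,M),\,k,\,((ns_1)s_2\cdots s_k,\ s_1s_2\cdots s_k),\,t\bigr).$$
   Context: For a positive integer $s$, $\mathbb{Z}_s=\{0,1,\dots,s-1\}$. Arrays are nonempty finite multisets of rows; $|A|$ counts rows with multiplicity. Let $G=\mathbb{Z}_{s_1}\times\cdots\times\mathbb{Z}_{s_k}$; for $I=\{i_1,\dots,i_t\}\subseteq\{1,\dots,k\}$ let $G_I=\mathbb{Z}_{s_{i_1}}\times\cdots\times\mathbb{Z}_{s_{i_t}}$ and let $\pi_I:G\to G_I$ be the coordinate projection. For $1\le t\le k$, a finite multiset $A$ of elements of $G$ is an orthogonal array of strength $t$ over $G$, denoted $\mathrm{OA}(|A|,s_1s_2\cdots s_k,t)$, if for every $I$ with $|I|=t$ there is a positive integer $\lambda_I$ with $|\{\alpha\in A:\pi_I(\alpha)=\beta\}|=\lambda_I$ for all $\beta\in G_I$ (counted with multiplicity). In this notation $s_1s_2\cdots s_k$ is the list of numbers of levels of the $k$ factors, not a product; $(ns_1)s_2\cdots s_k$ means that the first factor has $ns_1$ levels and factor $i\ge2$ has $s_i$ levels. Nested orthogonal array: let $S_i\ge R_i$ be positive integers for $1\le i\le k$, with strict inequality for at least one $i$. An $\mathrm{NOA}((N,M),k,(S_1S_2\cdots S_k,R_1R_2\cdots R_k),t)$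 is an $\mathrm{OA}(N,S_1\cdots S_k,t)$, $A$, over $\mathbb{Z}_{S_1}\times\cdots\times\mathbb{Z}_{S_k}$ that contains a subarray (sub-multiset of rows) $B$ whose rows lie in $\prod_i\{0,\dots,R_i-1\}$ and which is an $\mathrm{OA}(M,R_1\cdots R_k,t)$ over $\mathbb{Z}_{R_1}\times\cdots\times\mathbb{Z}_{R_k}$. Optimality: with the factors indexed so that $\frac{S_1}{R_1}=\max_i\frac{S_i}{R_i}$ (which holds for the array in the claim), such an NOA is called optimal if $N$ equals $$M\sum_{i=0}^{t/2}\sum_{\substack{I\subseteq\{1,\dots,k\}\\|I|=i}}\prod_{j\in I}\Bigl(\frac{S_j}{R_j}-1\Bigr)\quad\text{when } t \text{ is even},$$ $$M\left[\sum_{i=0}^{\lfloor t/2\rfloor}\sum_{\substack{I\subseteq\{1,\dots,k\}\\|I|=i}}\prod_{j\in I}\Bigl(\frac{S_j}{R_j}-1\Bigr)+\Bigl(\frac{S_1}{R_1}-1\Bigr)\sum_{\substack{I\subseteq\{2,\dots,k\}\\|I|=\lfloor t/2\rfloor}}\prod_{j\in I}\Bigl(\frac{S_j}{R_j}-1\Bigr)\right]\quad\text{when } t\text{ is odd}.$$ Empty products equal $1$. -}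

module Defs where

open import Data.Fin.Subset using (Subset; inside; outside; ∣_∣)
open import Data.Integer.Base using (+_)
open import Data.List.Base as List using (List; []; _∷_; _++_; length; filter; upTo)
open import Data.List.Relation.Binary.BagAndSetEquality using (_∼[_]_; subbag)
open import Data.List.Relation.Unary.All as ListAll using ()
open import Data.Nat.Base using (ℕ; zero; suc; _≤_; _<_; NonZero; ⌊_/2⌋)
import Data.Nat.Properties as ℕ
open import Data.Nat.Divisibility using (_∣_; _∤_)
open import Data.Product.Base using (∃-syntax; _×_)
open import Data.Rational.Base as ℚ using (ℚ; 0ℚ; 1ℚ; _/_)
open import Data.Vec.Base as Vec using (Vec; []; _∷_; lookup; head; tail)
import Data.Vec.Properties as Vec
open import Data.Vec.Relation.Binary.Pointwise.Inductive using (Pointwise)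
open import Data.Vec.Relation.Unary.All using (All; []; _∷_)
open import Relation.Binary.PropositionalEquality.Core using (_≡_)

private
  variable
    k m : ℕ

-- ℤ_s is the subset {0, …, s ∸ 1} of ℕ, so that ∏ᵢ ℤ_{Rᵢ} is literally
-- contained in ∏ᵢ ℤ_{Sᵢ} when Rᵢ ≤ Sᵢ; no reduction or embedding is involved.
infix 4 _∈∏ℤ_

_∈∏ℤ_ : Vec ℕ m → Vec ℕ m → Set
α ∈∏ℤ s = Pointwise _<_ α s

π : {X : Set} (I : Subset k) → Vec X k → Vec X ∣ I ∣
π []            []       = []
π (inside  ∷ I) (x ∷ xs) = x ∷ π I xs
π (outside ∷ I) (x ∷ xs) = π I xs

occurrences : (I : Subset k) → Vec ℕ ∣ I ∣ → List (Vec ℕ k) → ℕ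
occurrences I β A = length (filter (λ α → Vec.≡-dec ℕ._≟_ (π I α) β) A)

-- A multiset of rows is a list whose order is never used.
record OA (N : ℕ) (s : Vec ℕ k) (t : ℕ) : Set where
  field
    1≤t        : 1 ≤ t
    t≤k        : t ≤ k
    levels>0   : All NonZero s
    rows       : List (Vec ℕ k)
    nonEmpty   : NonZero N
    size       : length rows ≡ N
    rows∈G     : ListAll.All (_∈∏ℤ s) rows
    balanced   : (I : Subset k) → ∣ I ∣ ≡ t →
                 ∃[ λI ] 0 < λI ×
                   ((β : Vec ℕ ∣ I ∣) → β ∈∏ℤ π I s → occurrences I β rows ≡ λI)

-- B ∼[ subbag ] A says that B is contained in A counting multiplicities.
record NOA (N M : ℕ) (S R : Vec ℕ k) (t : ℕ) : Set where
  field
    R≤S      : Pointwise _≤_ R S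
    R<S      : ∃[ i ] lookup R i < lookup S i
    array    : OA N S t
    subarray : OA M R t
    nested   : OA.rows subarray ∼[ subbag ] OA.rows array

ratios : (S R : Vec ℕ k) → All NonZero R → Vec ℚ k
ratios []       []       []           = []
ratios (S ∷ Ss) (R ∷ Rs) (R≢0 ∷ Rs≢0) = _/_ (+ S) R {{R≢0}} ∷ ratios Ss Rs Rs≢0

sum : List ℚ → ℚ
sum = List.foldr ℚ._+_ 0ℚ

product : Vec ℚ m → ℚ
product = Vec.foldr′ ℚ._*_ 1ℚ

subsets : (k : ℕ) → List (Subset k)
subsets zero    = [] ∷ []
subsets (suc k) = List.map (outside ∷_) (subsets k) ++ List.map (inside ∷_) (subsets k)

-- ∑_{I ⊆ {1,…,k}, |I| = i} ∏_{j ∈ I} xⱼ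
sumOfProducts : ℕ → Vec ℚ k → ℚ
sumOfProducts {k} i x =
  sum (List.map (λ I → product (π I x)) (filter (λ I → ∣ I ∣ ℕ.≟ i) (subsets k)))

fromℕ : ℕ → ℚ
fromℕ n = + n / 1

record Optimal {N M : ℕ} {S R : Vec ℕ (suc k)} {t : ℕ} (D : NOA N M S R t) : Set where
  r : Vec ℚ (suc k)
  r = ratios S R (OA.levels>0 (NOA.subarray D))

  x : Vec ℚ (suc k)
  x = Vec.map (ℚ._- 1ℚ) r

  base : ℚ
  base = sum (List.map (λ i → sumOfProducts i x) (upTo (suc ⌊ t /2⌋)))

  field
    firstMax : ∀ i → lookup r i ℚ.≤ head r
    even     : 2 ∣ t → fromℕ N ≡ fromℕ M ℚ.* base
    -- Subsets of {2,…,k} are handled as subsets of the index set of tail x.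
    odd      : 2 ∤ t → fromℕ N ≡
               fromℕ M ℚ.* (base ℚ.+ head x ℚ.* sumOfProducts ⌊ t /2⌋ (tail x))

{-# OPTIONS --safe #-}
-- Stacking n copies of the OA, the j-th one with j s₁ added to its first
-- coordinate, gives an OA with n s₁ levels in the first factor: when I contains
-- the first factor exactly one copy contributes to a given β, otherwise all n
-- copies contribute equally.  The original OA is the copy j = 0.  Optimality
-- holds because x = (n − 1, 0, …, 0), so that only the subsets ∅ and {1}
-- contribute, and the bound is M (1 + (n − 1)).
module Submission where

open import Defs
open import Data.Bool.Base using (true; false)
open import Data.Fin.Base as Fin using (Fin)
open import Data.Fin.Subset using (Subset; inside; outside; ∣_∣)
open import Data.Integer.Base as ℤ using ()
import Data.Integer.Properties as ℤ
open import Data.List.Base as List using (List; []; _∷_; _++_; length; filter; upTo; applyUpTo)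
open import Data.List.Properties using (++-identityʳ; length-++; length-map; map-++; map-∘; map-applyUpTo; filter-++; filter-≐; filter-none)
open import Data.List.Relation.Binary.BagAndSetEquality using (_∼[_]_; subbag; ++-cong)
open import Data.List.Relation.Unary.All as ListAll using ()
import Data.List.Relation.Unary.All.Properties as ListAll
open import Data.Nat.Base using (ℕ; zero; suc; _+_; _*_; _∸_; _≤_; _<_; z≤n; s≤s; NonZero; ⌊_/2⌋; >-nonZero; >-nonZero⁻¹)
open import Data.Nat.Coprimality as Coprime using (1-coprimeTo)
import Data.Nat.Properties as ℕ
open import Data.Product.Base using (Σ-syntax; ∃-syntax; _×_; _,_)
open import Data.Rational.Base as ℚ using (ℚ; 0ℚ; 1ℚ; mkℚ; _/_)
import Data.Rational.Properties as ℚ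
import Data.Rational.Unnormalised.Base as ℚᵘ
open import Data.Vec.Base as Vec using (Vec; []; _∷_; lookup; head; tail; replicate)
import Data.Vec.Properties as Vec
open import Data.Vec.Relation.Binary.Pointwise.Inductive as Pointwise using (Pointwise; []; _∷_)
open import Data.Vec.Relation.Unary.All using (All; []; _∷_)
open import Function.Base using (_∘_; id)
open import Function.Related.Propositional using (K-refl)
open import Relation.Binary.PropositionalEquality
open import Relation.Nullary.Decidable using (yes; no; does)
open import Relation.Unary using (Decidable)

private
  variable
    k : ℕ
    X Y : Set

-- Counting occurrences in concatenated and mapped lists of rows.

filter-map : {P : Y → Set} (P? : Decidable P) (f : X → Y) (xs : List X) →
  filter P? (List.map f xs) ≡ List.map f (filter (P? ∘ f) xs)
filter-map P? f []       = refl
filter-map P? f (x ∷ xs) with does (P? (f x))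
... | true  = cong (f x ∷_) (filter-map P? f xs)
... | false = filter-map P? f xs

occurrences-++ : (I : Subset k) (β : Vec ℕ ∣ I ∣) (A B : List (Vec ℕ k)) →
  occurrences I β (A ++ B) ≡ occurrences I β A + occurrences I β B
occurrences-++ I β A B =
  trans (cong length (filter-++ _ A B)) (length-++ (filter _ A))

occurrences-none : (I : Subset k) (β : Vec ℕ ∣ I ∣) {A : List (Vec ℕ k)} →
  ListAll.All (λ α → π I α ≢ β) A → occurrences I β A ≡ 0
occurrences-none I β none = cong length (filter-none _ none)

-- Counting in an image means counting preimages under the pulled-back condition. For `shift` that
-- condition has the same form: the target stays fixed when `I` omits the first factor, and its
-- first entry drops by `s` otherwise.
occurrences-map : (I J : Subset k) (β : Vec ℕ ∣ I ∣) (γ : Vec ℕ ∣ J ∣) (f : Vec ℕ k → Vec ℕ k) →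
  (∀ α → π I (f α) ≡ β → π J α ≡ γ) → (∀ α → π J α ≡ γ → π I (f α) ≡ β) →
  (A : List (Vec ℕ k)) → occurrences I β (List.map f A) ≡ occurrences J γ A
occurrences-map I J β γ f to from A = begin
  occurrences I β (List.map f A)                              ≡⟨ cong length (filter-map _ f A) ⟩
  length (List.map f (filter _ A))                            ≡⟨ length-map f (filter _ A) ⟩
  length (filter (λ α → Vec.≡-dec ℕ._≟_ (π I (f α)) β) A)     ≡⟨ cong length (filter-≐ _ _ ((λ {α} → to α) , (λ {α} → from α)) A) ⟩
  occurrences J γ A                                           ∎
  where open ≡-Reasoning

-- Stacking shifted copies of an orthogonal array.

shift : ℕ → Vec ℕ (suc k) → Vec ℕ (suc k)
shift s (a ∷ α) = (s + a) ∷ α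

-- Each unfolding shifts all the remaining copies at once, so copy `j` is shifted `j` times in
-- total.
stack : ℕ → ℕ → List (Vec ℕ (suc k)) → List (Vec ℕ (suc k))
stack s zero    A = []
stack s (suc n) A = A ++ List.map (shift s) (stack s n A)

length-stack : ∀ s n (A : List (Vec ℕ (suc k))) → length (stack s n A) ≡ n * length A
length-stack s zero    A = refl
length-stack s (suc n) A = trans (length-++ A)
  (cong (length A +_) (trans (length-map (shift s) (stack s n A)) (length-stack s n A)))

stack-∈ : ∀ {s₁} {s : Vec ℕ k} n {A} →
  ListAll.All (_∈∏ℤ (s₁ ∷ s)) A → ListAll.All (_∈∏ℤ (n * s₁ ∷ s)) (stack s₁ n A)
stack-∈ zero    A∈ = ListAll.[]
stack-∈ {s₁ = s₁} (suc n) A∈ = ListAll.++⁺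
  (ListAll.map (λ { (a< ∷ α<) → ℕ.<-≤-trans a< (ℕ.m≤m+n s₁ (n * s₁)) ∷ α< }) A∈)
  (ListAll.gmap⁺ (λ { {_ ∷ _} (a< ∷ α<) → ℕ.+-monoʳ-< s₁ a< ∷ α< }) (stack-∈ n A∈))

-- `shift` does not change the coordinates selected by `outside ∷ I`, so every copy contributes the
-- same count.
occurrences-stack-outside : ∀ s n (I : Subset k) (β : Vec ℕ ∣ I ∣) A →
  occurrences (outside ∷ I) β (stack s n A) ≡ n * occurrences (outside ∷ I) β A
occurrences-stack-outside s zero    I β A = refl
occurrences-stack-outside s (suc n) I β A =
  trans (occurrences-++ (outside ∷ I) β A _)
    (cong (occurrences (outside ∷ I) β A +_)
      (trans (occurrences-map (outside ∷ I) (outside ∷ I) β β (shift s)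
               (λ { (_ ∷ _) → id }) (λ { (_ ∷ _) → id }) (stack s n A))
             (occurrences-stack-outside s n I β A)))

-- The levels split into blocks of length `s`. A level `b` below `s` is met only by the unshifted
-- copy, since shifted rows start at `s` or above; any other `b` is met only by the shifted ones.
-- The conclusion ranges over all `b` because the induction passes from `b` to `b ∸ s`; for `n` zero
-- no `b` exists.
occurrences-stack-inside : ∀ s n (I : Subset k) (β : Vec ℕ ∣ I ∣) {A} {l} →
  ListAll.All (λ α → head α < s) A →
  (∀ {b} → b < s → occurrences (inside ∷ I) (b ∷ β) A ≡ l) →
  ∀ {b} → b < n * s → occurrences (inside ∷ I) (b ∷ β) (stack s n A) ≡ l
occurrences-stack-inside s (suc n) I β {A} {l} A<s bal {b} b< with b ℕ.<? s
... | yes b<s = begin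
  occ b (A ++ B)        ≡⟨ occurrences-++ (inside ∷ I) (b ∷ β) A B ⟩
  occ b A + occ b B     ≡⟨ cong₂ _+_ (bal b<s) (occurrences-none (inside ∷ I) (b ∷ β) (ListAll.map⁺ (ListAll.universal above (stack s n A)))) ⟩
  l + 0                 ≡⟨ ℕ.+-identityʳ l ⟩
  l                     ∎
  where
  open ≡-Reasoning
  B = List.map (shift s) (stack s n A)
  occ : ℕ → List _ → ℕ
  occ b = occurrences (inside ∷ I) (b ∷ β)
  above : ∀ α → π (inside ∷ I) (shift s α) ≢ b ∷ β
  above (a ∷ α) eq = ℕ.<⇒≱ b<s (subst (s ≤_) (Vec.∷-injectiveˡ eq) (ℕ.m≤m+n s a))
... | no b≮s = begin
  occ b (A ++ B)        ≡⟨ occurrences-++ (inside ∷ I) (b ∷ β) A B ⟩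
  occ b A + occ b B     ≡⟨ cong (_+ occ b B) (occurrences-none (inside ∷ I) (b ∷ β) (ListAll.map (λ {α} → below α) A<s)) ⟩
  occ b B               ≡⟨ occurrences-map (inside ∷ I) (inside ∷ I) (b ∷ β) (c ∷ β) (shift s) to from (stack s n A) ⟩
  occ c (stack s n A)   ≡⟨ occurrences-stack-inside s n I β A<s bal c< ⟩
  l                     ∎
  where
  open ≡-Reasoning
  B = List.map (shift s) (stack s n A)
  occ : ℕ → List _ → ℕ
  occ b = occurrences (inside ∷ I) (b ∷ β)
  -- Undoing one shift turns level `b` of the shifted part into level `c` of the smaller stack.
  c = b ∸ s
  s+c≡b : s + c ≡ b
  s+c≡b = ℕ.m+[n∸m]≡n (ℕ.≮⇒≥ b≮s)
  c< : c < n * s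
  c< = ℕ.+-cancelˡ-< s c (n * s) (subst (_< s + n * s) (sym s+c≡b) b<)
  below : ∀ α → head α < s → π (inside ∷ I) α ≢ b ∷ β
  below (a ∷ α) a<s eq = b≮s (subst (_< s) (Vec.∷-injectiveˡ eq) a<s)
  to : ∀ α → π (inside ∷ I) (shift s α) ≡ b ∷ β → π (inside ∷ I) α ≡ c ∷ β
  to (a ∷ α) eq = cong₂ _∷_
    (ℕ.+-cancelˡ-≡ s a c (trans (Vec.∷-injectiveˡ eq) (sym s+c≡b))) (Vec.∷-injectiveʳ eq)
  from : ∀ α → π (inside ∷ I) α ≡ c ∷ β → π (inside ∷ I) (shift s α) ≡ b ∷ β
  from (a ∷ α) eq = cong₂ _∷_
    (trans (cong (s +_) (Vec.∷-injectiveˡ eq)) s+c≡b) (Vec.∷-injectiveʳ eq)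

-- The index of `I` carries over from `A` when `I` contains the first factor and is multiplied by
-- `n` otherwise.
stackOA : ∀ n .{{n≢0 : NonZero n}} {M s₁ t} {s : Vec ℕ k} → OA M (s₁ ∷ s) t → OA (n * M) (n * s₁ ∷ s) t
stackOA n {{n≢0}} {M} {s₁} {t} {s} A = record
  { 1≤t      = 1≤t
  ; t≤k      = t≤k
  ; levels>0 = stack-levels levels>0
  ; rows     = stack s₁ n rows
  ; nonEmpty = ℕ.m*n≢0 n M {{n≢0}} {{nonEmpty}}
  ; size     = trans (length-stack s₁ n rows) (cong (n *_) size)
  ; rows∈G   = stack-∈ n rows∈G
  ; balanced = stack-balanced
  }
  where
  open OA A
  stack-levels : All NonZero (s₁ ∷ s) → All NonZero (n * s₁ ∷ s)
  stack-levels (s₁≢0 ∷ s≢0) = ℕ.m*n≢0 n s₁ {{n≢0}} {{s₁≢0}} ∷ s≢0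
  stack-balanced : (I : Subset _) → ∣ I ∣ ≡ t → ∃[ l ] 0 < l ×
    (∀ β → β ∈∏ℤ π I (n * s₁ ∷ s) → occurrences I β (stack s₁ n rows) ≡ l)
  stack-balanced (inside ∷ I) eq with balanced (inside ∷ I) eq
  ... | l , 0<l , bal = l , 0<l , λ
    { (b ∷ β) (b< ∷ β<) → occurrences-stack-inside s₁ n I β
        (ListAll.map (λ { (a< ∷ _) → a< }) rows∈G) (λ b<s₁ → bal _ (b<s₁ ∷ β<)) b< }
  stack-balanced (outside ∷ I) eq with balanced (outside ∷ I) eq
  ... | l , 0<l , bal = n * l , >-nonZero⁻¹ _ {{ℕ.m*n≢0 n l {{n≢0}} {{>-nonZero 0<l}}}} , λ β β< →
    trans (occurrences-stack-outside s₁ n I β rows) (cong (n *_) (bal β β<))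

stack-subbag : ∀ s n .{{_ : NonZero n}} (A : List (Vec ℕ (suc k))) → A ∼[ subbag ] stack s n A
-- Written as `A ++ []`, the array embeds blockwise: the identity on `A`, and the empty injection
-- into the shifted copies.
stack-subbag s (suc n) A {z} = subst (λ B → B ∼[ subbag ] stack s (suc n) A) (++-identityʳ A)
  (λ {z} → ++-cong {k = subbag} {xs₁ = A} {xs₂ = A} (K-refl {k = subbag}) []-subbag {z}) {z}
  where
  []-subbag : [] ∼[ subbag ] List.map (shift s) (stack s n A)
  []-subbag = record { to = λ () ; cong = λ { refl → refl } ; injective = λ { {()} } }

-- Level ratios as rational numbers.

-- For a variable `n` the fraction `+ n / 1` is stuck on a gcd computation; the explicit normal form
-- lets products and comparisons unfold.
fromℕ-mkℚ : ∀ n → fromℕ n ≡ mkℚ (ℤ.+ n) 0 (Coprime.sym (1-coprimeTo n))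
fromℕ-mkℚ n = ℚ.normalize-coprime (Coprime.sym (1-coprimeTo n))

fromℕ-* : ∀ m n → fromℕ m ℚ.* fromℕ n ≡ fromℕ (m * n)
fromℕ-* m n rewrite fromℕ-mkℚ m | fromℕ-mkℚ n = cong (_/ 1) (sym (ℤ.pos-* m n))

fromℕ-mono-≤ : ∀ {m n} → m ≤ n → fromℕ m ℚ.≤ fromℕ n
fromℕ-mono-≤ {m} {n} m≤n rewrite fromℕ-mkℚ m | fromℕ-mkℚ n =
  ℚ.*≤* (ℤ.*-monoʳ-≤-nonNeg (ℤ.+ 1) (ℤ.+≤+ m≤n))

n*s/s≡n : ∀ n s .{{_ : NonZero s}} → ℤ.+ (n * s) / s ≡ fromℕ n
-- It suffices to cross-multiply unnormalised fractions. `mkℚᵘ` stores the denominator minus one,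
-- hence `s` and `0`.
n*s/s≡n n (suc s) = ℚ.fromℚᵘ-cong {ℚᵘ.mkℚᵘ (ℤ.+ (n * suc s)) s} {ℚᵘ.mkℚᵘ (ℤ.+ n) 0}
  (ℚᵘ.*≡* (trans (ℤ.*-identityʳ _) (ℤ.pos-* n (suc s))))

ratios-refl : (s : Vec ℕ k) (s≢0 : All NonZero s) → ratios s s s≢0 ≡ replicate k 1ℚ
ratios-refl []      []          = refl
ratios-refl (s ∷ ss) (s≢0 ∷ ss≢0) = cong₂ _∷_
  -- Reading `s` as `1 * s` makes this the case of ratio 1.
  (trans (cong (λ m → _/_ (ℤ.+ m) s {{s≢0}}) (sym (ℕ.*-identityˡ s))) (n*s/s≡n 1 s {{s≢0}}))
  (ratios-refl ss ss≢0)

-- Elementary symmetric polynomials.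

sum-++ : (xs ys : List ℚ) → sum (xs ++ ys) ≡ sum xs ℚ.+ sum ys
sum-++ []       ys = sym (ℚ.+-identityˡ _)
sum-++ (x ∷ xs) ys = trans (cong (x ℚ.+_) (sum-++ xs ys)) (sym (ℚ.+-assoc x _ _))

sum-*ˡ : (f : X → ℚ) (c : ℚ) (xs : List X) →
  sum (List.map (λ x → c ℚ.* f x) xs) ≡ c ℚ.* sum (List.map f xs)
sum-*ˡ f c []       = sym (ℚ.*-zeroʳ c)
sum-*ˡ f c (x ∷ xs) = trans (cong (c ℚ.* f x ℚ.+_) (sum-*ˡ f c xs)) (sym (ℚ.*-distribˡ-+ c _ _))

sum-zeros : ∀ n {f : ℕ → ℚ} → (∀ i → f i ≡ 0ℚ) → sum (applyUpTo f n) ≡ 0ℚ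
sum-zeros zero    f≡0 = refl
sum-zeros (suc n) f≡0 = trans (cong₂ ℚ._+_ (f≡0 0) (sum-zeros n (f≡0 ∘ suc))) (ℚ.+-identityˡ 0ℚ)

-- The subsets are separated by whether they contain the first index. The condition `suc ∣ I ∣ ≡ i`
-- stays unsimplified so that both `i = 0`, where no `I` satisfies it, and `i` positive can be
-- derived from here.
sumOfProducts-split : ∀ i (x : ℚ) (xs : Vec ℚ k) →
  sumOfProducts i (x ∷ xs) ≡ sumOfProducts i xs ℚ.+
    sum (List.map (λ I → x ℚ.* product (π I xs)) (filter (λ I → suc ∣ I ∣ ℕ.≟ i) (subsets k)))
sumOfProducts-split {k} i x xs = begin
  sum (List.map p (filter P? (os ++ is)))                            ≡⟨ cong (sum ∘ List.map p) (filter-++ P? os is) ⟩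
  sum (List.map p (filter P? os ++ filter P? is))                    ≡⟨ cong sum (map-++ p (filter P? os) _) ⟩
  sum (List.map p (filter P? os) ++ List.map p (filter P? is))       ≡⟨ sum-++ (List.map p (filter P? os)) _ ⟩
  sum (List.map p (filter P? os)) ℚ.+ sum (List.map p (filter P? is)) ≡⟨ cong₂ (λ u v → sum u ℚ.+ sum v) (push (outside ∷_)) (push (inside ∷_)) ⟩
  _ ∎
  where
  open ≡-Reasoning
  os = List.map (outside ∷_) (subsets k)
  is = List.map (inside ∷_) (subsets k)
  p : Subset (suc k) → ℚ
  p I = product (π I (x ∷ xs))
  P? : Decidable (λ (I : Subset (suc k)) → ∣ I ∣ ≡ i)
  P? I = ∣ I ∣ ℕ.≟ i
  push : (f : Subset k → Subset (suc k)) →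
    List.map p (filter P? (List.map f (subsets k))) ≡ List.map (p ∘ f) (filter (P? ∘ f) (subsets k))
  push f = trans (cong (List.map p) (filter-map P? f (subsets k))) (sym (map-∘ _))

sumOfProducts-zero : (xs : Vec ℚ k) → sumOfProducts 0 xs ≡ 1ℚ
sumOfProducts-zero []       = refl
sumOfProducts-zero {suc k} (x ∷ xs) = begin
  sumOfProducts 0 (x ∷ xs)       ≡⟨ sumOfProducts-split 0 x xs ⟩
  sumOfProducts 0 xs ℚ.+ _       ≡⟨ cong₂ ℚ._+_ (sumOfProducts-zero xs)
                                      (cong (sum ∘ List.map _) (filter-none _ (ListAll.universal (λ _ ()) (subsets k)))) ⟩
  1ℚ                             ∎
  where open ≡-Reasoning

-- This is the Pascal-type recurrence of elementary symmetric polynomials; with the value 1 in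
-- degree 0 it determines all the sums below.
sumOfProducts-suc : ∀ i (x : ℚ) (xs : Vec ℚ k) →
  sumOfProducts (suc i) (x ∷ xs) ≡ sumOfProducts (suc i) xs ℚ.+ x ℚ.* sumOfProducts i xs
sumOfProducts-suc {k} i x xs = trans (sumOfProducts-split (suc i) x xs)
  (cong (sumOfProducts (suc i) xs ℚ.+_)
    (trans (cong (sum ∘ List.map _) (filter-≐ _ _ (ℕ.suc-injective , cong suc) (subsets k)))
           (sum-*ˡ (λ I → product (π I xs)) x (filter (λ I → ∣ I ∣ ℕ.≟ i) (subsets k)))))

sumOfProducts-zeros : ∀ k i → sumOfProducts (suc i) (replicate k 0ℚ) ≡ 0ℚ
sumOfProducts-zeros zero    i = refl
sumOfProducts-zeros (suc k) i = begin
  sumOfProducts (suc i) (0ℚ ∷ replicate k 0ℚ) ≡⟨ sumOfProducts-suc i 0ℚ (replicate k 0ℚ) ⟩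
  sumOfProducts (suc i) (replicate k 0ℚ) ℚ.+ 0ℚ ℚ.* sumOfProducts i (replicate k 0ℚ)
    ≡⟨ cong₂ ℚ._+_ (sumOfProducts-zeros k i) (ℚ.*-zeroˡ (sumOfProducts i (replicate k 0ℚ))) ⟩
  0ℚ ∎
  where open ≡-Reasoning

-- With a single possibly nonzero variable `p`, degree 0 gives 1, degree 1 gives `p`, and higher
-- degrees vanish. The range `upTo (suc (suc h))` always includes degrees 0 and 1.
sum-sumOfProducts : ∀ k h (p : ℚ) →
  sum (List.map (λ i → sumOfProducts i (p ∷ replicate k 0ℚ)) (upTo (suc (suc h)))) ≡ p ℚ.+ 1ℚ
sum-sumOfProducts k h p = begin
  sum (List.map e (upTo (suc (suc h))))                   ≡⟨ cong sum (map-applyUpTo id e (suc (suc h))) ⟩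
  e 0 ℚ.+ (e 1 ℚ.+ sum (applyUpTo (e ∘ suc ∘ suc) h))     ≡⟨ cong₂ ℚ._+_ (sumOfProducts-zero (p ∷ replicate k 0ℚ)) (cong₂ ℚ._+_ e₁ (sum-zeros h e₂₊)) ⟩
  1ℚ ℚ.+ (p ℚ.+ 0ℚ)                                       ≡⟨ cong (1ℚ ℚ.+_) (ℚ.+-identityʳ p) ⟩
  1ℚ ℚ.+ p                                                ≡⟨ ℚ.+-comm 1ℚ p ⟩
  p ℚ.+ 1ℚ                                                ∎
  where
  open ≡-Reasoning
  0s = replicate k 0ℚ
  e : ℕ → ℚ
  e i = sumOfProducts i (p ∷ 0s)
  e₁ : e 1 ≡ p
  e₁ = begin
    e 1                                             ≡⟨ sumOfProducts-suc 0 p 0s ⟩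
    sumOfProducts 1 0s ℚ.+ p ℚ.* sumOfProducts 0 0s ≡⟨ cong₂ (λ u v → u ℚ.+ p ℚ.* v) (sumOfProducts-zeros k 0) (sumOfProducts-zero 0s) ⟩
    0ℚ ℚ.+ p ℚ.* 1ℚ                                 ≡⟨ ℚ.+-identityˡ _ ⟩
    p ℚ.* 1ℚ                                        ≡⟨ ℚ.*-identityʳ p ⟩
    p                                               ∎
  e₂₊ : ∀ i → e (suc (suc i)) ≡ 0ℚ
  e₂₊ i = begin
    e (suc (suc i))                                                   ≡⟨ sumOfProducts-suc (suc i) p 0s ⟩
    sumOfProducts (suc (suc i)) 0s ℚ.+ p ℚ.* sumOfProducts (suc i) 0s ≡⟨ cong₂ (λ u v → u ℚ.+ p ℚ.* v) (sumOfProducts-zeros k (suc i)) (sumOfProducts-zeros k i) ⟩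
    0ℚ ℚ.+ p ℚ.* 0ℚ                                                   ≡⟨ cong (0ℚ ℚ.+_) (ℚ.*-zeroʳ p) ⟩
    0ℚ                                                                ∎

-- The nested array and its optimality.

ratios-stack : ∀ n s₁ (s : Vec ℕ k) (s≢0 : All NonZero (s₁ ∷ s)) →
  ratios (n * s₁ ∷ s) (s₁ ∷ s) s≢0 ≡ fromℕ n ∷ replicate k 1ℚ
ratios-stack n s₁ s (s₁≢0 ∷ s≢0) = cong₂ _∷_ (n*s/s≡n n s₁ {{s₁≢0}}) (ratios-refl s s≢0)

firstMax-stack : ∀ n .{{_ : NonZero n}} (i : Fin (suc k)) →
  lookup (fromℕ n ∷ replicate k 1ℚ) i ℚ.≤ fromℕ n
firstMax-stack n Fin.zero    = ℚ.≤-refl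
firstMax-stack n (Fin.suc i) = subst (ℚ._≤ fromℕ n) (sym (Vec.lookup-replicate i 1ℚ))
  (fromℕ-mono-≤ (>-nonZero⁻¹ n))

theorem4p10 : (n k-1 t M s₁ : ℕ) (s : Vec ℕ k-1) →
    2 ≤ n → 2 ≤ t → t ≤ suc k-1 →
    NonZero M → All NonZero (s₁ ∷ s) →
    OA M (s₁ ∷ s) t →
    Σ[ D ∈ NOA (n * M) M ((n * s₁) ∷ s) (s₁ ∷ s) t ] Optimal D
-- Matching `t` as `suc (suc t′)` reduces `⌊ t /2⌋` to `suc ⌊ t′ /2⌋`, so the sum reaches degree 1
-- and the subsets in the odd term are nonempty.
theorem4p10 n@(suc (suc _)) k t@(suc (suc t′)) M s₁ s
  (s≤s (s≤s z≤n)) (s≤s (s≤s z≤n)) _ _ (s₁≢0 ∷ _) A = D , record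
  { firstMax = subst (λ r → ∀ i → lookup r i ℚ.≤ head r) (sym r≡) (firstMax-stack n)
  ; even     = λ _ → trans (sym M*n) (cong (fromℕ M ℚ.*_) (sym base≡))
  ; odd      = λ _ → trans (sym M*n) (cong (fromℕ M ℚ.*_) (sym oddBase≡))
  }
  where
  open ≡-Reasoning
  D : NOA (n * M) M (n * s₁ ∷ s) (s₁ ∷ s) t
  D = record
    { R≤S      = ℕ.m≤n*m s₁ n ∷ Pointwise.refl ℕ.≤-refl
    -- The strict increase is in the first factor: `1 * s₁ < n * s₁`.
    ; R<S      = Fin.zero , subst (_< n * s₁) (ℕ.*-identityˡ s₁) (ℕ.*-monoˡ-< s₁ {{s₁≢0}} {1} {n} (s≤s (s≤s z≤n)))
    ; array    = stackOA n A
    ; subarray = A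
    ; nested   = stack-subbag s₁ n (OA.rows A)
    }
  p : ℚ
  p = fromℕ n ℚ.- 1ℚ
  r≡ : ratios (n * s₁ ∷ s) (s₁ ∷ s) (OA.levels>0 A) ≡ fromℕ n ∷ replicate k 1ℚ
  r≡ = ratios-stack n s₁ s (OA.levels>0 A)
  x : Vec ℚ (suc k)
  x = Vec.map (ℚ._- 1ℚ) (ratios (n * s₁ ∷ s) (s₁ ∷ s) (OA.levels>0 A))
  x≡ : x ≡ p ∷ replicate k 0ℚ
  x≡ = trans (cong (Vec.map (ℚ._- 1ℚ)) r≡) (cong (p ∷_) (Vec.map-replicate (ℚ._- 1ℚ) 1ℚ k))
  base : Vec ℚ (suc k) → ℚ
  base x = sum (List.map (λ i → sumOfProducts i x) (upTo (suc ⌊ t /2⌋)))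
  p+1≡n : p ℚ.+ 1ℚ ≡ fromℕ n
  -- After reassociation, `- 1ℚ + 1ℚ` evaluates to `0ℚ`.
  p+1≡n = trans (ℚ.+-assoc (fromℕ n) (ℚ.- 1ℚ) 1ℚ) (ℚ.+-identityʳ (fromℕ n))
  base≡ : base x ≡ fromℕ n
  base≡ = trans (cong base x≡) (trans (sum-sumOfProducts k ⌊ t′ /2⌋ p) p+1≡n)
  -- Each product in the additional odd term has a zero factor, because its subset of the remaining
  -- factors is nonempty; both parities thus give the same value `n`.
  oddBase≡ : base x ℚ.+ head x ℚ.* sumOfProducts ⌊ t /2⌋ (tail x) ≡ fromℕ n
  oddBase≡ = begin
    base x ℚ.+ head x ℚ.* sumOfProducts ⌊ t /2⌋ (tail x)
      ≡⟨ cong₂ (λ b y → b ℚ.+ head x ℚ.* sumOfProducts ⌊ t /2⌋ (tail y)) base≡ x≡ ⟩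
    fromℕ n ℚ.+ head x ℚ.* sumOfProducts ⌊ t /2⌋ (replicate k 0ℚ)
      ≡⟨ cong (λ y → fromℕ n ℚ.+ head x ℚ.* y) (sumOfProducts-zeros k ⌊ t′ /2⌋) ⟩
    fromℕ n ℚ.+ head x ℚ.* 0ℚ ≡⟨ cong (fromℕ n ℚ.+_) (ℚ.*-zeroʳ (head x)) ⟩
    fromℕ n ℚ.+ 0ℚ            ≡⟨ ℚ.+-identityʳ _ ⟩
    fromℕ n                   ∎
  M*n : fromℕ M ℚ.* fromℕ n ≡ fromℕ (n * M)
  M*n = trans (fromℕ-* M n) (cong fromℕ (ℕ.*-comm M n))
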